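{- For every integer $i\ge2$ and every graph $G$, $\hom(S_{2,1^{i-2}};G)\cdot\hom(S_{2,1^{i}};G)\ge \hom(S_{2,1^{i-1}};G)^2$.
   Context: All graphs are finite; $\hom(H;G)$ is the number of graph homomorphisms from $H$ to $G$. For $k\ge0$, $S_{2,1^k}$ is the tree with vertex set $\{1,\ldots,k+3\}$ and edge set $\{\{1,j\}:2\le j\le k+2\}\cup\{\{k+2,k+3\}\}$. -}

module Defs where

open import Level using (0ℓ)
open import Data.Nat using (ℕ; suc; _+_; _≤_; s≤s; _^_; _≤?_; _≟_)
open import Data.Nat.Properties using (1+n≢n; +-suc)
open import Data.Fin using (Fin; toℕ; finToFun)
open import Data.Fin.Properties using (all?)
open import Data.List using (length; filter; allFin)
open import Data.Product using (_×_; _,_)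
open import Data.Sum using (_⊎_; inj₁; inj₂)
open import Function using (_on_)
open import Relation.Binary using (Rel; Symmetric; Irreflexive; Decidable)
open import Relation.Binary.PropositionalEquality using (_≡_; refl; sym; trans)
open import Relation.Binary.Construct.Closure.Symmetric as Sym using (SymClosure; fwd; bwd)
open import Relation.Nullary using (Dec; ¬_)
open import Relation.Nullary.Decidable using (map′; _×-dec_; _⊎-dec_; _→-dec_)

-- Finite simple graphs; adjacency is decidable so that homomorphisms can be
-- counted.
record Graph : Set₁ where
  field
    order  : ℕ
    Adj    : Rel (Fin order) 0ℓ
    adj?   : Decidable Adj
    symm   : Symmetric Adj
    irrefl : Irreflexive _≡_ Adj

open Graph public using (order; Adj; adj?)

IsHom : (H G : Graph) → (Fin (order H) → Fin (order G)) → Set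
IsHom H G f = ∀ u v → Adj H u v → Adj G (f u) (f v)

isHom? : (H G : Graph) (f : Fin (order H) → Fin (order G)) → Dec (IsHom H G f)
isHom? H G f = all? λ u → all? λ v → adj? H u v →-dec adj? G (f u) (f v)

-- finToFun enumerates each map Fin (order H) → Fin (order G) exactly once
-- (up to pointwise equality), as its index runs over Fin (order G ^ order H).
hom : Graph → Graph → ℕ
hom H G = length (filter (λ c → isHom? H G (finToFun c)) (allFin (order G ^ order H)))

-- The edges of S_{2,1^k} on the vertex names 1, …, k + 3, with each unordered
-- pair {a , b} listed with a < b.
data Edge (k : ℕ) : ℕ → ℕ → Set where
  spoke : ∀ {j} → 2 ≤ j → j ≤ k + 2 → Edge k 1 j
  outer : Edge k (k + 2) (k + 3)

-- The vertex named j is the element of Fin (k + 3) with value j - 1.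
name : ∀ {n} → Fin n → ℕ
name u = suc (toℕ u)

edge? : ∀ k → Decidable (Edge k)
edge? k a b =
  map′ to from
    ((a ≟ 1 ×-dec 2 ≤? b ×-dec b ≤? k + 2) ⊎-dec (a ≟ k + 2 ×-dec b ≟ k + 3))
  where
  Cond : Set
  Cond = (a ≡ 1 × 2 ≤ b × b ≤ k + 2) ⊎ (a ≡ k + 2 × b ≡ k + 3)

  to : Cond → Edge k a b
  to (inj₁ (refl , p , q)) = spoke p q
  to (inj₂ (refl , refl))  = outer

  from : Edge k a b → Cond
  from (spoke p q) = inj₁ (refl , p , q)
  from outer       = inj₂ (refl , refl)

k+3≢k+2 : ∀ k → ¬ (k + 3 ≡ k + 2)
k+3≢k+2 k eq = 1+n≢n (trans (sym (+-suc k 2)) eq)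

edge-irrefl : ∀ k {a b} → Edge k a b → ¬ (a ≡ b)
edge-irrefl k (spoke (s≤s ()) _) refl
edge-irrefl k outer              eq = k+3≢k+2 k (sym eq)

S₂,₁^ : ℕ → Graph
S₂,₁^ k = record
  { order  = k + 3
  ; Adj    = SymClosure (Edge k on name)
  ; adj?   = λ u v → map′ (λ { (inj₁ e) → fwd e ; (inj₂ e) → bwd e })
                          (λ { (fwd e) → inj₁ e ; (bwd e) → inj₂ e })
                          (edge? k (name u) (name v) ⊎-dec edge? k (name v) (name u))
  ; symm   = Sym.symmetric (Edge k on name)
  ; irrefl = λ { refl (fwd e) → edge-irrefl k e refl
               ; refl (bwd e) → edge-irrefl k e refl }
  }

{-# OPTIONS --safe #-}

-- Classify the homomorphisms by the image x of the centre.  Each of the k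
-- leaves at the centre maps independently to one of the deg x neighbours of x,
-- so hom(S_{2,1^k}; G) = Σ_x (deg x)^k · w(x), where w(x) counts the walks of
-- length two from x.  The inequality is then the Cauchy–Schwarz inequality for
-- the weights (deg x)^{i-2} · w(x).
module Submission where

open import Defs
open import Data.Bool using (true; false; if_then_else_)
open import Data.Fin
  using (Fin; zero; suc; toℕ; _↑ˡ_; _↑ʳ_; combine; remQuot; quotient; remainder; finToFun)
open import Data.Fin.Properties using (all?; remQuot-combine)
open import Data.List using (length; filter; tabulate)
open import Data.Nat using (ℕ; zero; suc; _+_; _*_; _∸_; _^_; _≤_; _≥_; z≤n; s≤s; s≤s⁻¹)
open import Data.Nat.Properties
open import Data.Nat.Tactic.RingSolver using (solve-∀)
open import Data.Product using (_×_; _,_; uncurry)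
open import Data.Sum using (_⊎_; inj₁; inj₂)
open import Function using (_∘_; _⇔_; mk⇔)
open import Relation.Binary.Construct.Closure.Symmetric using (fwd; bwd)
open import Relation.Binary.PropositionalEquality
  using (_≡_; refl; sym; trans; cong; cong₂; subst; subst₂; module ≡-Reasoning)
open import Relation.Nullary using (Dec; does; contradiction)
open import Relation.Nullary.Decidable using (_×-dec_; _→-dec_; does-⇔)
open import Relation.Unary using (Pred; Decidable)
open import Algebra.Properties.Semiring.Sum +-*-semiring
  using (sum; sum-syntax; sum-cong-≗; *-distribˡ-sum; *-distribʳ-sum)

-- Weighted Cauchy-Schwarz over the natural numbers.

m≤n⇒2mn≤m²+n² : ∀ {m n} → m ≤ n → 2 * (m * n) ≤ m * m + n * n
m≤n⇒2mn≤m²+n² {m} m≤n with c , refl ← m≤n⇒∃[o]m+o≡n m≤n =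
  -- With `c` the difference of the two numbers, the slack is exactly `c * c`.
  ≤-trans (m≤m+n _ (c * c)) (≤-reflexive (expand m c))
  where
  expand : ∀ m c → 2 * (m * (m + c)) + c * c ≡ m * m + (m + c) * (m + c)
  expand = solve-∀

2mn≤m²+n² : ∀ m n → 2 * (m * n) ≤ m * m + n * n
2mn≤m²+n² m n with ≤-total m n
... | inj₁ m≤n = m≤n⇒2mn≤m²+n² m≤n
... | inj₂ n≤m =
  subst₂ _≤_ (cong (2 *_) (*-comm n m)) (+-comm (n * n) (m * m)) (m≤n⇒2mn≤m²+n² n≤m)

-- This is Σ wᵢ (a - dᵢ)² ≥ 0 with the negative terms moved across, so that no subtraction occurs in
-- `ℕ`. It controls the cross terms in `cauchy-schwarz`.
weighted-2mn≤m²+n² : ∀ {n} a (d w : Fin n → ℕ) →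
  2 * (a * ∑[ i < n ] (d i * w i)) ≤ a * a * sum w + ∑[ i < n ] (d i * (d i * w i))
weighted-2mn≤m²+n² {zero}  a d w = ≤-trans (≤-reflexive (cong (2 *_) (*-zeroʳ a))) z≤n
weighted-2mn≤m²+n² {suc n} a d w = begin
  2 * (a * (d₀ * w₀ + s))
    ≡⟨ split a d₀ w₀ s ⟩
  2 * (a * d₀) * w₀ + 2 * (a * s)
    ≤⟨ +-mono-≤ (*-monoˡ-≤ w₀ (2mn≤m²+n² a d₀)) (weighted-2mn≤m²+n² a (d ∘ suc) (w ∘ suc)) ⟩
  (a * a + d₀ * d₀) * w₀ + (a * a * p + q)
    ≡⟨ regroup a d₀ w₀ p q ⟩
  a * a * (w₀ + p) + (d₀ * (d₀ * w₀) + q) ∎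
  where
  open ≤-Reasoning
  d₀ = d zero
  w₀ = w zero
  s = ∑[ i < n ] (d (suc i) * w (suc i))
  p = sum (w ∘ suc)
  q = ∑[ i < n ] (d (suc i) * (d (suc i) * w (suc i)))

  split : ∀ a d w s → 2 * (a * (d * w + s)) ≡ 2 * (a * d) * w + 2 * (a * s)
  split = solve-∀

  regroup : ∀ a d w p q →
    (a * a + d * d) * w + (a * a * p + q) ≡ a * a * (w + p) + (d * (d * w) + q)
  regroup = solve-∀

-- The vectors behind it are √wᵢ and dᵢ √wᵢ; in this form no roots appear. By induction on `n`:
-- after index 0 is split off, the terms in `d₀` and `w₀` alone agree on both sides, and the terms
-- free of them are the induction hypothesis. The mixed terms are `weighted-2mn≤m²+n²` at `a = d₀`,
-- multiplied by `w₀`.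
cauchy-schwarz : ∀ {n} (d w : Fin n → ℕ) →
  (∑[ i < n ] (d i * w i)) * (∑[ i < n ] (d i * w i)) ≤ sum w * ∑[ i < n ] (d i * (d i * w i))
cauchy-schwarz {zero}  d w = z≤n
cauchy-schwarz {suc n} d w = begin
  (d₀ * w₀ + s) * (d₀ * w₀ + s)
    ≡⟨ square d₀ w₀ s ⟩
  d₀ * w₀ * (d₀ * w₀) + w₀ * (2 * (d₀ * s)) + s * s
    ≤⟨ +-mono-≤ (+-monoʳ-≤ (d₀ * w₀ * (d₀ * w₀))
                  (*-monoʳ-≤ w₀ (weighted-2mn≤m²+n² d₀ (d ∘ suc) (w ∘ suc))))
                (cauchy-schwarz (d ∘ suc) (w ∘ suc)) ⟩
  d₀ * w₀ * (d₀ * w₀) + w₀ * (d₀ * d₀ * p + q) + p * q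
    ≡⟨ factor d₀ w₀ p q ⟩
  (w₀ + p) * (d₀ * (d₀ * w₀) + q) ∎
  where
  open ≤-Reasoning
  d₀ = d zero
  w₀ = w zero
  s = ∑[ i < n ] (d (suc i) * w (suc i))
  p = sum (w ∘ suc)
  q = ∑[ i < n ] (d (suc i) * (d (suc i) * w (suc i)))

  square : ∀ d w s →
    (d * w + s) * (d * w + s) ≡ d * w * (d * w) + w * (2 * (d * s)) + s * s
  square = solve-∀

  factor : ∀ d w p q →
    d * w * (d * w) + w * (d * d * p + q) + p * q ≡ (w + p) * (d * (d * w) + q)
  factor = solve-∀

-- Counting by sums of indicators.

𝟙 : ∀ {a} {A : Set a} → Dec A → ℕ
𝟙 a? = if does a? then 1 else 0

𝟙-⇔ : ∀ {a b} {A : Set a} {B : Set b} → A ⇔ B → (a? : Dec A) (b? : Dec B) → 𝟙 a? ≡ 𝟙 b?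
𝟙-⇔ A⇔B a? b? = cong (if_then 1 else 0) (does-⇔ A⇔B a? b?)

𝟙-× : ∀ {a b} {A : Set a} {B : Set b} (a? : Dec A) (b? : Dec B) →
  𝟙 (a? ×-dec b?) ≡ 𝟙 a? * 𝟙 b?
𝟙-× a? b? with does a?
... | true  = sym (*-identityˡ (𝟙 b?))
... | false = refl

length-filter-tabulate : ∀ {a p} {A : Set a} {P : Pred A p} (P? : Decidable P) {n} (f : Fin n → A) →
  length (filter P? (tabulate f)) ≡ ∑[ i < n ] 𝟙 (P? (f i))
length-filter-tabulate P? {zero}  f = refl
length-filter-tabulate P? {suc n} f with does (P? (f zero))
... | true  = cong suc (length-filter-tabulate P? (f ∘ suc))
... | false = length-filter-tabulate P? (f ∘ suc)

sum-↑ : ∀ m {n} (f : Fin (m + n) → ℕ) →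
  sum f ≡ ∑[ i < m ] f (i ↑ˡ n) + ∑[ j < n ] f (m ↑ʳ j)
sum-↑ zero    f = refl
sum-↑ (suc m) f = trans (cong (f zero +_) (sum-↑ m (f ∘ suc))) (sym (+-assoc (f zero) _ _))

sum-combine : ∀ m {n} (f : Fin (m * n) → ℕ) →
  sum f ≡ ∑[ i < m ] ∑[ j < n ] f (combine i j)
sum-combine zero        f = refl
sum-combine (suc m) {n} f =
  trans (sum-↑ n f) (cong (∑[ j < n ] f (j ↑ˡ (m * n)) +_) (sum-combine m (f ∘ (n ↑ʳ_))))

-- `finToFun` decodes the value at `zero` as a quotient and the remaining values from the remainder.
-- Hence this turns a sum over coded maps into a double sum: over the image of the first vertex,
-- then over the maps of the others.
sum-remQuot : ∀ m {n} (f : Fin m → Fin n → ℕ) →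
  ∑[ c < m * n ] f (quotient n c) (remainder {m} n c) ≡ ∑[ i < m ] ∑[ j < n ] f i j
sum-remQuot m {n} f = trans (sum-combine m (uncurry f ∘ remQuot {m} n))
  (sum-cong-≗ λ i → sum-cong-≗ λ j → cong (uncurry f) (remQuot-combine i j))

-- Homomorphisms from `S₂,₁^ k`, sorted by the image of the centre.

edge-view : ∀ {k a b} → Edge k a b → (a ≡ 1 × 2 ≤ b × b ≤ k + 2) ⊎ (a ≡ k + 2 × b ≡ k + 3)
edge-view (spoke 2≤b b≤k+2) = inj₁ (refl , 2≤b , b≤k+2)
edge-view outer             = inj₂ (refl , refl)

module _ (G : Graph) where

  private
    n = order G

  -- The number N of vertices is kept separate from k so that k + 3 can be
  -- replaced by suc (k + 2), on which finToFun computes.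
  MapsEdges : ∀ k N → (Fin N → Fin n) → Set
  MapsEdges k N f = ∀ u v → Edge k (name u) (name v) → Adj G (f u) (f v)

  mapsEdges? : ∀ k N f → Dec (MapsEdges k N f)
  mapsEdges? k N f = all? λ u → all? λ v → edge? k (name u) (name v) →-dec adj? G (f u) (f v)

  isHom⇔mapsEdges : ∀ k f → IsHom (S₂,₁^ k) G f ⇔ MapsEdges k (k + 3) f
  isHom⇔mapsEdges k f = mk⇔
    (λ hom u v e → hom u v (fwd e))
    (λ { maps u v (fwd e) → maps u v e ; maps u v (bwd e) → Graph.symm G (maps v u e) })

  -- h lists the images of the vertices 2, …, k + 3; the peeled-off h zero is the
  -- image of a leaf at the centre.
  Around : Fin n → ∀ k → (Fin (k + 2) → Fin n) → Set
  Around x zero    h = Adj G x (h zero) × Adj G (h zero) (h (suc zero))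
  Around x (suc k) h = Adj G x (h zero) × Around x k (h ∘ suc)

  around? : ∀ x k h → Dec (Around x k h)
  around? x zero    h = adj? G x (h zero) ×-dec adj? G (h zero) (h (suc zero))
  around? x (suc k) h = adj? G x (h zero) ×-dec around? x k (h ∘ suc)

  -- A bridge between `MapsEdges` and the recursive `Around`. Since `h j` is the image of the vertex
  -- named `toℕ j + 2`, the bound `toℕ j ≤ k` selects the neighbours 2, ..., k + 2 of the centre,
  -- and the values `k`, `suc k` are the ends of the outer edge.
  AroundByIndex : Fin n → ∀ k → (Fin (k + 2) → Fin n) → Set
  AroundByIndex x k h =
    (∀ j → toℕ j ≤ k → Adj G x (h j)) ×
    (∀ i j → toℕ i ≡ k → toℕ j ≡ suc k → Adj G (h i) (h j))

  aroundByIndex⇒around : ∀ x k h → AroundByIndex x k h → Around x k h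
  aroundByIndex⇒around x zero    h (p , q) = p zero z≤n , q zero (suc zero) refl refl
  aroundByIndex⇒around x (suc k) h (p , q) = p zero z≤n ,
    aroundByIndex⇒around x k (h ∘ suc)
      ( (λ j j≤k → p (suc j) (s≤s j≤k))
      , (λ i j i≡k j≡1+k → q (suc i) (suc j) (cong suc i≡k) (cong suc j≡1+k)))

  around⇒spokes : ∀ x k h → Around x k h → ∀ j → toℕ j ≤ k → Adj G x (h j)
  around⇒spokes x zero    h (a , _) zero    _         = a
  around⇒spokes x (suc k) h (a , _) zero    _         = a
  around⇒spokes x (suc k) h (_ , r) (suc j) (s≤s j≤k) = around⇒spokes x k (h ∘ suc) r j j≤k

  around⇒outer : ∀ x k h → Around x k h →
    ∀ i j → toℕ i ≡ k → toℕ j ≡ suc k → Adj G (h i) (h j)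
  around⇒outer x zero    h (_ , b) zero    (suc zero) _   _   = b
  around⇒outer x (suc k) h (_ , r) (suc i) (suc j)    i≡k j≡k =
    around⇒outer x k (h ∘ suc) r i j (suc-injective i≡k) (suc-injective j≡k)

  mapsEdges⇔around : ∀ k f → MapsEdges k (suc (k + 2)) f ⇔ Around (f zero) k (f ∘ suc)
  mapsEdges⇔around k f = mk⇔
    (λ maps → aroundByIndex⇒around (f zero) k (f ∘ suc)
      ( (λ j j≤k → maps zero (suc j)
          (spoke (s≤s (s≤s z≤n)) (subst (2 + toℕ j ≤_) (+-comm 2 k) (s≤s (s≤s j≤k)))))
      , (λ i j i≡k j≡1+k → maps (suc i) (suc j)
          (subst₂ (Edge k)
            (sym (trans (cong (2 +_) i≡k) (+-comm 2 k)))
            (sym (trans (cong (2 +_) j≡1+k) (+-comm 3 k)))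
            outer))))
    (λ around u v e → from around u v (edge-view e))
    where
    -- The edge enters as equations between names, via `edge-view`: matching on `outer` directly
    -- would require unifying `k + 2` with a successor of some `toℕ`.
    from : Around (f zero) k (f ∘ suc) → ∀ u v →
      (name u ≡ 1 × 2 ≤ name v × name v ≤ k + 2) ⊎ (name u ≡ k + 2 × name v ≡ k + 3) →
      Adj G (f u) (f v)
    from around zero    zero    (inj₁ (_ , s≤s () , _))
    from around zero    (suc j) (inj₁ (_ , _ , j≤)) = around⇒spokes (f zero) k (f ∘ suc) around j
      (s≤s⁻¹ (s≤s⁻¹ (subst (2 + toℕ j ≤_) (+-comm k 2) j≤)))
    -- The centre is named 1, so it is not an end of the outer edge.
    from around zero    v       (inj₂ (1≡k+2 , _)) = contradiction (trans 1≡k+2 (+-comm k 2)) λ ()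
    from around (suc i) zero    (inj₂ (_ , 1≡k+3)) = contradiction (trans 1≡k+3 (+-comm k 3)) λ ()
    from around (suc i) (suc j) (inj₂ (i≡ , j≡)) = around⇒outer (f zero) k (f ∘ suc) around i j
      (suc-injective (suc-injective (trans i≡ (+-comm k 2))))
      (suc-injective (suc-injective (trans j≡ (+-comm k 3))))

  degree : Fin n → ℕ
  degree x = ∑[ y < n ] 𝟙 (adj? G x y)

  #around : Fin n → ℕ → ℕ
  #around x k = ∑[ c < n ^ (k + 2) ] 𝟙 (around? x k (finToFun c))

  -- The first leaf is constrained only by adjacency to `x`. The indicator is therefore a product of
  -- a factor in its image and a factor in the rest, and the double sum factors.
  #around-suc : ∀ x k → #around x (suc k) ≡ degree x * #around x k
  #around-suc x k = begin
    ∑[ c < n * n ^ (k + 2) ] 𝟙 (around? x (suc k) (finToFun c))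
      ≡⟨ sum-cong-≗ {n * n ^ (k + 2)} (λ c →
           𝟙-× (adj? G x (quotient (n ^ (k + 2)) c)) (around? x k _)) ⟩
    ∑[ c < n * n ^ (k + 2) ]
      (spokeAt (quotient (n ^ (k + 2)) c) * rest (remainder {n} (n ^ (k + 2)) c))
      ≡⟨ sum-remQuot n (λ y c → spokeAt y * rest c) ⟩
    ∑[ y < n ] ∑[ c < n ^ (k + 2) ] (spokeAt y * rest c)
      ≡⟨ sum-cong-≗ (λ y → sym (*-distribˡ-sum (spokeAt y) rest)) ⟩
    ∑[ y < n ] (spokeAt y * #around x k)
      ≡⟨ sym (*-distribʳ-sum (#around x k) spokeAt) ⟩
    degree x * #around x k ∎
    where
    open ≡-Reasoning
    spokeAt : Fin n → ℕ
    spokeAt y = 𝟙 (adj? G x y)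
    rest : Fin (n ^ (k + 2)) → ℕ
    rest c = 𝟙 (around? x k (finToFun c))

  hom-S₂,₁^ : ∀ k → hom (S₂,₁^ k) G ≡ ∑[ x < n ] #around x k
  hom-S₂,₁^ k = begin
    hom (S₂,₁^ k) G
      ≡⟨ length-filter-tabulate (λ c → isHom? (S₂,₁^ k) G (finToFun c)) (λ c → c) ⟩
    ∑[ c < n ^ (k + 3) ] 𝟙 (isHom? (S₂,₁^ k) G (finToFun c))
      -- `isHom?` ties the number of vertices to `k + 3`; passing to `mapsEdges?` frees it, so that
      -- it can be rewritten to `suc (k + 2)` in the exponent and in the domain at once.
      ≡⟨ sum-cong-≗ {n ^ (k + 3)} (λ c →
           𝟙-⇔ (isHom⇔mapsEdges k (finToFun c))
               (isHom? (S₂,₁^ k) G (finToFun c)) (mapsEdges? k _ (finToFun c))) ⟩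
    ∑[ c < n ^ (k + 3) ] 𝟙 (mapsEdges? k (k + 3) (finToFun c))
      ≡⟨ cong (λ N → ∑[ c < n ^ N ] 𝟙 (mapsEdges? k N (finToFun c))) (+-suc k 2) ⟩
    ∑[ c < n ^ suc (k + 2) ] 𝟙 (mapsEdges? k (suc (k + 2)) (finToFun c))
      ≡⟨ sum-cong-≗ {n ^ suc (k + 2)} (λ c →
           𝟙-⇔ (mapsEdges⇔around k (finToFun c)) (mapsEdges? k _ (finToFun c)) (around? _ k _)) ⟩
    ∑[ c < n * n ^ (k + 2) ]
      𝟙 (around? (quotient (n ^ (k + 2)) c) k (finToFun (remainder {n} (n ^ (k + 2)) c)))
      ≡⟨ sum-remQuot n (λ x c → 𝟙 (around? x k (finToFun c))) ⟩
    ∑[ x < n ] #around x k ∎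
    where open ≡-Reasoning

theorem3p4 : (i : ℕ) → 2 ≤ i → (G : Graph) →
    hom (S₂,₁^ (i ∸ 2)) G * hom (S₂,₁^ i) G ≥ hom (S₂,₁^ (i ∸ 1)) G ^ 2
theorem3p4 (suc (suc k)) (s≤s (s≤s z≤n)) G = begin
  h₁ ^ 2      ≡⟨ cong (h₁ *_) (*-identityʳ h₁) ⟩
  h₁ * h₁     ≡⟨ cong₂ _*_ h₁≡ h₁≡ ⟩
  (∑[ x < n ] (d x * w x)) * (∑[ x < n ] (d x * w x))
              ≤⟨ cauchy-schwarz d w ⟩
  sum w * ∑[ x < n ] (d x * (d x * w x))
              ≡⟨ cong₂ _*_ (hom-S₂,₁^ G k) h₂≡ ⟨
  hom (S₂,₁^ k) G * hom (S₂,₁^ (2 + k)) G ∎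
  where
  open ≤-Reasoning
  n = order G
  d = degree G
  -- This is the whole Cauchy-Schwarz weight, (deg x)^k times the number of walks of length two from
  -- `x`. Its power is never expanded: each increment of `k` contributes one factor `d x` through
  -- `#around-suc`.
  w : Fin n → ℕ
  w x = #around G x k
  h₁ = hom (S₂,₁^ (suc k)) G

  h₁≡ : h₁ ≡ ∑[ x < n ] (d x * w x)
  h₁≡ = trans (hom-S₂,₁^ G (suc k)) (sum-cong-≗ λ x → #around-suc G x k)

  h₂≡ : hom (S₂,₁^ (2 + k)) G ≡ ∑[ x < n ] (d x * (d x * w x))
  h₂≡ = trans (hom-S₂,₁^ G (2 + k))
    (sum-cong-≗ λ x → trans (#around-suc G x (suc k)) (cong (d x *_) (#around-suc G x k)))
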